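{- Let $q$ be a prime power, $m$ a positive integer, and $k=q^\ell+1$ where $\ell$ is an integer with $1\le\ell<\frac m2$, $\ell\mid m$ and $m/\ell$ even. If $\gcd(k,q^m-1)\neq q^{m/2}+1$, then the Waring number satisfies $g(q^\ell+1,q^m)=2$; that is, every element of $\mathbb F_{q^m}$ can be written as $x^{q^\ell+1}+y^{q^\ell+1}$ with $x,y\in\mathbb F_{q^m}$, and not every element is a single $(q^\ell+1)$-th power.
   Context: For a positive integer $k$ and a prime power $Q$, the Waring number $g(k,Q)$ is the smallest integer $s$ such that every element of $\mathbb F_Q$ can be written as a sum $x_1^k+\cdots+x_s^k$ with $x_i\in\mathbb F_Q$. -}

module Defs where

open import Level using (Level; _⊔_)
open import Data.Nat using (ℕ; zero; suc; _≤_; _^_)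
open import Data.Nat.Primality using (Prime)
open import Data.Fin using (Fin)
open import Data.Product using (Σ; ∃; _×_; _,_)
open import Relation.Nullary using (¬_)
open import Relation.Binary.PropositionalEquality using (_≡_)
import Relation.Binary.PropositionalEquality as ≡
open import Algebra.Bundles using (CommutativeRing)
open import Function.Bundles using (Bijection)

IsPrimePower : ℕ → Set
IsPrimePower q = Σ ℕ λ p → Σ ℕ λ n → Prime p × 1 ≤ n × q ≡ p ^ n

record Field (c ℓ : Level) : Set (Level.suc (c ⊔ ℓ)) where
  field
    commutativeRing : CommutativeRing c ℓ
  open CommutativeRing commutativeRing public
  field
    0≉1     : ¬ (0# ≈ 1#)
    inverse : ∀ x → ¬ (x ≈ 0#) → ∃ λ y → x * y ≈ 1#

record FiniteField (c ℓ : Level) (Q : ℕ) : Set (Level.suc (c ⊔ ℓ)) where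
  field
    fld : Field c ℓ
  open Field fld public
  field
    card : Bijection setoid (≡.setoid (Fin Q))

module _ {c ℓ : Level} (F : Field c ℓ) where
  open Field F

  pow : Carrier → ℕ → Carrier
  pow x zero    = 1#
  pow x (suc n) = x * pow x n

  SumOfTwoPowers : ℕ → Set (c ⊔ ℓ)
  SumOfTwoPowers k = ∀ a → ∃ λ x → ∃ λ y → pow x k + pow y k ≈ a

  AllPowers : ℕ → Set (c ⊔ ℓ)
  AllPowers k = ∀ a → ∃ λ x → pow x k ≈ a

  WaringNumberIsTwo : ℕ → Set (c ⊔ ℓ)
  WaringNumberIsTwo k = SumOfTwoPowers k × ¬ AllPowers k

{-# OPTIONS --safe #-}
{-
Write r = q^ℓ and σx = x^r, so the field has r^t elements with t ≥ 4 even, contains K = {x : σσx = x} and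
Nx = xσx maps K onto the σ-fixed elements. Over K the form x^{r+1} + y^{r+1} is equivalent to
κ(σu v − u σv) with κ ∈ K; putting v = uw, an element a is represented as soon as some s ≠ 0 makes
(a/κ) s^{r+1} lie in I = {w − σw}.
Modulo I every x is congruent to σx, and the trace shows that the quotient by I is a line over the fixed
field. Hence s ↦ a s^{r+1} mod I is a Hermitian form on a K-space of dimension t/2 ≥ 2: if 1 is not isotropic
then it has a nonzero orthogonal vector w outside K, and s = e + w is isotropic when e ∈ K has the norm
that cancels the value at w.
-}
module Submission where

open import Defs
open import Level using (Level)
open import Data.Nat using (ℕ; _+_; _*_; _∸_; _^_; _≤_; _<_; _/_)
open import Data.Nat.Divisibility using (_∣_)
open import Data.Nat.GCD using (gcd)
open import Data.Product using (Σ; _×_)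
open import Relation.Binary.PropositionalEquality using (_≡_; _≢_)

open import Data.Empty using (⊥-elim)
open import Data.Fin using (Fin; zero; suc; toℕ; punchIn; punchOut)
open import Data.Fin.Permutation using (Permutation′; permutation)
open import Data.Nat using (zero; suc; z≤n; s≤s; _!; >-nonZero; nonTrivial⇒n>1)
open import Data.Product using (∃; _,_; proj₁; proj₂)
open import Data.Sum using (inj₁; inj₂)
open import Data.Vec using (Vec; []; _∷_)
open import Function using (_∘_)
open import Function.Bundles using (Bijection)
open import Relation.Binary.PropositionalEquality using (refl; cong; sym; trans; subst)
open import Relation.Nullary using (¬_; Dec; yes; no)
import Data.Fin.Properties as Fin
import Data.Nat.Combinatorics as Comb
import Data.Nat.Divisibility as Div
import Data.Nat.DivMod as DivMod
import Data.Nat.Primality as Prim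
import Data.Nat.Properties as ℕ
import Relation.Nullary.Decidable as Dec

open Comb using (_C_)

-- Arithmetic of prime binomial coefficients and of powers.

prime∣!⇒≤ : ∀ {p} → Prim.Prime p → ∀ n → p ∣ n ! → p ≤ n
prime∣!⇒≤ pr zero    p∣1 = ⊥-elim (Prim.¬prime[1] (subst Prim.Prime (Div.∣1⇒≡1 p∣1) pr))
prime∣!⇒≤ pr (suc n) p∣ with Prim.euclidsLemma (suc n) (n !) pr p∣
... | inj₁ p∣1+n = Div.∣⇒≤ p∣1+n
... | inj₂ p∣n!  = ℕ.m≤n⇒m≤1+n (prime∣!⇒≤ pr n p∣n!)

-- `p` divides `p !`, the product of the binomial coefficient with two factorials of numbers below
-- `p`, and a prime divides no such factorial.
prime∣C : ∀ {p} k → Prim.Prime p → 0 < k → k < p → p ∣ (p C k)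
prime∣C {p} k pr 0<k k<p with Prim.euclidsLemma (p C k) (k ! * (p ∸ k) !) pr p∣product
  where
  k≤p = ℕ.<⇒≤ k<p
  instance k!*≢0 = k ℕ.!* (p ∸ k) !≢0
  p! : p ! ≡ (p C k) * (k ! * (p ∸ k) !)
  p! = trans (sym (DivMod.m/n*n≡m (Comb.k![n∸k]!∣n! k≤p)))
             (cong (_* (k ! * (p ∸ k) !)) (sym (Comb.nCk≡n!/k![n-k]! k≤p)))
  p∣p! : ∀ {n} → 0 < n → n ∣ n !
  p∣p! {suc n} _ = Div.m∣m*n (n !)
  p∣product = subst (p ∣_) p! (p∣p! (ℕ.≤-<-trans z≤n k<p))
... | inj₁ p∣C = p∣C
... | inj₂ p∣k!*[p-k]! with Prim.euclidsLemma (k !) ((p ∸ k) !) pr p∣k!*[p-k]!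
...   | inj₁ p∣k!     = ⊥-elim (ℕ.<⇒≱ k<p (prime∣!⇒≤ pr k p∣k!))
...   | inj₂ p∣[p-k]! =
        ⊥-elim (ℕ.<⇒≱ (ℕ.∸-monoʳ-< 0<k (ℕ.<⇒≤ k<p)) (prime∣!⇒≤ pr (p ∸ k) p∣[p-k]!))

-- Used with R = r² - 1 and s = t/2: the witness M is then (r^t - 1)/(r² - 1), obtained without a
-- division.
[1+R]^s≡1+M*R : ∀ R s → ∃ λ M → suc R ^ s ≡ suc (M * R)
[1+R]^s≡1+M*R R zero    = 0 , refl
[1+R]^s≡1+M*R R (suc s) with [1+R]^s≡1+M*R R s
... | M , eq = M + suc (M * R) , (begin
  suc R * suc R ^ s                ≡⟨ cong (suc R *_) eq ⟩
  suc (M * R + R * suc (M * R))    ≡⟨ cong (λ n → suc (M * R + n)) (ℕ.*-comm R (suc (M * R))) ⟩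
  suc (M * R + suc (M * R) * R)    ≡⟨ cong suc (sym (ℕ.*-distribʳ-+ R M (suc (M * R)))) ⟩
  suc ((M + suc (M * R)) * R)      ∎)
  where open Relation.Binary.PropositionalEquality.≡-Reasoning

-- Cancellation in a field.

module FieldProperties {c ℓ : Level} (F : Field c ℓ) where
  open Field F renaming (_+_ to _⊕_; _*_ to _⊗_; zero to ⊗-zero; refl to ≈-refl; sym to ≈-sym; trans to ≈-trans)
  open import Algebra.Properties.CommutativeSemiring.Exp commutativeSemiring
    renaming (_^_ to _^^_)
  open import Algebra.Properties.Semiring.Mult semiring renaming (_×_ to _·_)
  open import Algebra.Properties.CommutativeSemiring.Binomial commutativeSemiring
    using (binomialTerm; theorem)
  open import Algebra.Properties.Semiring.Sum semiring
    using (sum; sum-init-last; sum-cong-≋; sum-replicate-zero)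
  open import Algebra.Solver.Ring.NaturalCoefficients.Default commutativeSemiring
    using (solve; _:+_; _:*_; _:=_; con)
  open import Relation.Binary.Reasoning.Setoid setoid

  pow≈^ : ∀ x n → pow F x n ≈ x ^^ n
  pow≈^ x zero    = ≈-refl
  pow≈^ x (suc n) = *-congˡ (pow≈^ x n)

  0^suc≈0 : ∀ n → 0# ^^ suc n ≈ 0#
  0^suc≈0 n = zeroˡ _

  1^n≈1 : ∀ n → 1# ^^ n ≈ 1#
  1^n≈1 zero    = ≈-refl
  1^n≈1 (suc n) = ≈-trans (*-identityˡ _) (1^n≈1 n)

  +-cancelʳ : ∀ z {x y} → x ⊕ z ≈ y ⊕ z → x ≈ y
  +-cancelʳ z {x} {y} eq = begin
    x               ≈⟨ x≈x+z-z x ⟩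
    (x ⊕ z) ⊕ - z   ≈⟨ +-congʳ eq ⟩
    (y ⊕ z) ⊕ - z   ≈⟨ ≈-sym (x≈x+z-z y) ⟩
    y               ∎
    where
    x≈x+z-z : ∀ x → x ≈ (x ⊕ z) ⊕ - z
    x≈x+z-z x = ≈-sym (≈-trans (+-assoc x z (- z)) (≈-trans (+-congˡ (-‿inverseʳ z)) (+-identityʳ x)))

  *-cancelˡ : ∀ {x y z} → ¬ x ≈ 0# → x ⊗ y ≈ x ⊗ z → y ≈ z
  *-cancelˡ {x} {y} {z} x≉0 eq with inverse x x≉0
  ... | x⁻¹ , xx⁻¹≈1 = begin
    y              ≈⟨ y≈x⁻¹xy y ⟩
    x⁻¹ ⊗ (x ⊗ y)  ≈⟨ *-congˡ eq ⟩
    x⁻¹ ⊗ (x ⊗ z)  ≈⟨ ≈-sym (y≈x⁻¹xy z) ⟩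
    z              ∎
    where
    y≈x⁻¹xy : ∀ y → y ≈ x⁻¹ ⊗ (x ⊗ y)
    y≈x⁻¹xy y = ≈-sym (≈-trans (solve 3 (λ i x y → i :* (x :* y) := (x :* i) :* y) ≈-refl x⁻¹ x y)
                        (≈-trans (*-congʳ xx⁻¹≈1) (*-identityˡ y)))

  xy≈0⇒y≈0 : ∀ {x y} → ¬ x ≈ 0# → x ⊗ y ≈ 0# → y ≈ 0#
  xy≈0⇒y≈0 x≉0 eq = *-cancelˡ x≉0 (≈-trans eq (≈-sym (zeroʳ _)))

  *-nonzero : ∀ {x y} → ¬ x ≈ 0# → ¬ y ≈ 0# → ¬ x ⊗ y ≈ 0#
  *-nonzero x≉0 y≉0 = y≉0 ∘ xy≈0⇒y≈0 x≉0

  ^-nonzero : ∀ {x} n → ¬ x ≈ 0# → ¬ x ^^ n ≈ 0#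
  ^-nonzero zero    x≉0 = 0≉1 ∘ ≈-sym
  ^-nonzero (suc n) x≉0 = *-nonzero x≉0 (^-nonzero n x≉0)

  factor-nonzeroʳ : ∀ {x y} → x ⊗ y ≈ 1# → ¬ y ≈ 0#
  factor-nonzeroʳ xy≈1 y≈0 = 0≉1 (≈-trans (≈-sym (≈-trans (*-congˡ y≈0) (zeroʳ _))) xy≈1)

  -- Monic polynomials and the number of their roots.

  -- The vector of lower coefficients, constant term first, of a monic polynomial.
  eval : ∀ {n} → Vec Carrier n → Carrier → Carrier
  eval []       x = 1#
  eval (c ∷ cs) x = c ⊕ x ⊗ eval cs x

  quotient : ∀ {n} → Carrier → Vec Carrier (suc n) → Vec Carrier n
  quotient a (c ∷ [])         = []
  quotient a (c ∷ cs@(_ ∷ _)) = eval cs a ∷ quotient a cs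

  -- eval cs x − eval cs a = (x − a) · eval (quotient a cs) x, with the subtractions moved across.
  eval-quotient : ∀ {n} a (cs : Vec Carrier (suc n)) x →
    eval cs x ⊕ a ⊗ eval (quotient a cs) x ≈ eval cs a ⊕ x ⊗ eval (quotient a cs) x
  eval-quotient a (c ∷ []) x =
    solve 3 (λ a c x → (c :+ x :* con 1) :+ a :* con 1 := (c :+ a :* con 1) :+ x :* con 1) ≈-refl a c x
  eval-quotient a (c ∷ cs@(_ ∷ _)) x = begin
    (c ⊕ x ⊗ ex) ⊕ a ⊗ (ea ⊕ x ⊗ qx)
      ≈⟨ solve 6 (λ a c x ex ea qx → (c :+ x :* ex) :+ a :* (ea :+ x :* qx) :=
                   (c :+ a :* ea) :+ x :* (ex :+ a :* qx)) ≈-refl a c x ex ea qx ⟩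
    (c ⊕ a ⊗ ea) ⊕ x ⊗ (ex ⊕ a ⊗ qx)
      ≈⟨ +-congˡ (*-congˡ (eval-quotient a cs x)) ⟩
    (c ⊕ a ⊗ ea) ⊕ x ⊗ (ea ⊕ x ⊗ qx) ∎
    where
    ex = eval cs x
    ea = eval cs a
    qx = eval (quotient a cs) x

  -- Dividing by X - `ρ zero` lowers the degree by one, and the other values of `ρ` remain roots of
  -- the quotient because they differ from `ρ zero` and a field has no zero divisors.
  root-bound : ∀ {n} (cs : Vec Carrier n) {m} (ρ : Fin m → Carrier) →
    (∀ i j → i ≢ j → ¬ ρ i ≈ ρ j) → (∀ i → eval cs (ρ i) ≈ 0#) → m ≤ n
  root-bound cs       {zero}  ρ distinct root = z≤n
  root-bound []       {suc m} ρ distinct root = ⊥-elim (0≉1 (≈-sym (root zero)))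
  root-bound cs@(_ ∷ _) {suc m} ρ distinct root =
    s≤s (root-bound (quotient a cs) (ρ ∘ suc)
      (λ i j i≢j → distinct (suc i) (suc j) (i≢j ∘ Fin.suc-injective))
      (λ i → xy≈0⇒y≈0 (x-a≉0 i) (shifted i)))
    where
    a = ρ zero
    x-a≉0 : ∀ i → ¬ ρ (suc i) ⊕ - a ≈ 0#
    x-a≉0 i eq = distinct (suc i) zero (λ ()) (+-cancelʳ (- a) (≈-trans eq (≈-sym (-‿inverseʳ a))))
    shifted : ∀ i → (ρ (suc i) ⊕ - a) ⊗ eval (quotient a cs) (ρ (suc i)) ≈ 0#
    shifted i = begin
      (x ⊕ - a) ⊗ qx           ≈⟨ distribʳ qx x (- a) ⟩
      x ⊗ qx ⊕ - a ⊗ qx        ≈⟨ +-congʳ (≈-sym ax≈xx) ⟩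
      a ⊗ qx ⊕ - a ⊗ qx        ≈⟨ ≈-sym (distribʳ qx a (- a)) ⟩
      (a ⊕ - a) ⊗ qx           ≈⟨ *-congʳ (-‿inverseʳ a) ⟩
      0# ⊗ qx                  ≈⟨ zeroˡ qx ⟩
      0#                       ∎
      where
      x = ρ (suc i)
      qx = eval (quotient a cs) x
      ax≈xx : a ⊗ qx ≈ x ⊗ qx
      ax≈xx = begin
        a ⊗ qx              ≈⟨ ≈-sym (+-identityˡ _) ⟩
        0# ⊕ a ⊗ qx         ≈⟨ +-congʳ (≈-sym (root (suc i))) ⟩
        eval cs x ⊕ a ⊗ qx  ≈⟨ eval-quotient a cs x ⟩
        eval cs a ⊕ x ⊗ qx  ≈⟨ +-congʳ (root zero) ⟩
        0# ⊕ x ⊗ qx         ≈⟨ +-identityˡ _ ⟩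
        x ⊗ qx              ∎

  -- A predicate on functions, so that a polynomial can be given by any pointwise equal expression
  -- while its exact degree stays in the type.
  Monic : ℕ → (Carrier → Carrier) → Set _
  Monic n f = ∃ λ (cs : Vec Carrier n) → ∀ x → f x ≈ eval cs x

  monic-1 : Monic 0 (λ _ → 1#)
  monic-1 = [] , λ _ → ≈-refl

  monic-+* : ∀ {n f} c → Monic n f → Monic (suc n) (λ x → c ⊕ x ⊗ f x)
  monic-+* c (cs , f≈cs) = c ∷ cs , λ x → +-congˡ (*-congˡ (f≈cs x))

  monic-cong : ∀ {n f g} → (∀ x → g x ≈ f x) → Monic n f → Monic n g
  monic-cong g≈f (cs , f≈cs) = cs , λ x → ≈-trans (g≈f x) (f≈cs x)

  monic-^* : ∀ {n f} k → Monic n f → Monic (k + n) (λ x → x ^^ k ⊗ f x)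
  monic-^* zero    mf = monic-cong (λ x → *-identityˡ _) mf
  monic-^* (suc k) mf = monic-cong (λ x → ≈-trans (*-assoc _ _ _) (≈-sym (+-identityˡ _))) (monic-+* 0# (monic-^* k mf))

  monic-^ : ∀ n → Monic n (_^^ n)
  monic-^ zero    = monic-1
  monic-^ (suc n) = monic-cong (λ x → ≈-sym (+-identityˡ _)) (monic-+* 0# (monic-^ n))

  -- Only the coefficient at position `d` changes, and `d < n` protects the leading one. The trace
  -- polynomial is assembled this way.
  monic-+^ : ∀ {n f} d → d < n → Monic n f → Monic n (λ x → x ^^ d ⊕ f x)
  monic-+^ zero    (s≤s _)   (c ∷ cs , f≈cs) =
    1# ⊕ c ∷ cs , λ x → ≈-trans (+-congˡ (f≈cs x)) (≈-sym (+-assoc _ _ _))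
  monic-+^ (suc d) (s≤s d<n) (c ∷ cs , f≈cs) with monic-+^ d d<n (cs , λ _ → ≈-refl)
  ... | cs′ , eq = c ∷ cs′ , λ x → begin
    x ⊗ x ^^ d ⊕ _                     ≈⟨ +-congˡ (f≈cs x) ⟩
    x ⊗ x ^^ d ⊕ (c ⊕ x ⊗ eval cs x)
      ≈⟨ solve 4 (λ x y c e → x :* y :+ (c :+ x :* e) := c :+ x :* (y :+ e)) ≈-refl x (x ^^ d) c (eval cs x) ⟩
    c ⊕ x ⊗ (x ^^ d ⊕ eval cs x)       ≈⟨ +-congˡ (*-congˡ (eq x)) ⟩
    c ⊕ x ⊗ eval cs′ x                 ∎

  -- Σ_{i ≤ n} yⁱ z^{n−i} = (y^{n+1} − z^{n+1}) / (y − z)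
  geometric : Carrier → ℕ → Carrier → Carrier
  geometric z zero    y = 1#
  geometric z (suc n) y = z ^^ suc n ⊕ y ⊗ geometric z n y

  geometric-sum : ∀ z n y → y ⊗ geometric z n y ⊕ z ^^ suc n ≈ z ⊗ geometric z n y ⊕ y ^^ suc n
  geometric-sum z zero    y = +-comm _ _
  geometric-sum z (suc n) y = begin
    y ⊗ (zⁿ ⊕ y ⊗ g) ⊕ z ⊗ zⁿ
      ≈⟨ solve 4 (λ y z a g → y :* (a :+ y :* g) :+ z :* a := y :* (y :* g :+ a) :+ z :* a) ≈-refl y z zⁿ g ⟩
    y ⊗ (y ⊗ g ⊕ zⁿ) ⊕ z ⊗ zⁿ   ≈⟨ +-congʳ (*-congˡ (geometric-sum z n y)) ⟩
    y ⊗ (z ⊗ g ⊕ yⁿ) ⊕ z ⊗ zⁿ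
      ≈⟨ solve 5 (λ y z a b g → y :* (z :* g :+ b) :+ z :* a := z :* (a :+ y :* g) :+ y :* b) ≈-refl y z zⁿ yⁿ g ⟩
    z ⊗ (zⁿ ⊕ y ⊗ g) ⊕ y ⊗ yⁿ   ∎
    where
    zⁿ = z ^^ suc n
    yⁿ = y ^^ suc n
    g = geometric z n y

  monic-geometric : ∀ z k n → Monic (n * suc k) (λ x → geometric z n (x ^^ suc k))
  monic-geometric z k zero    = monic-1
  monic-geometric z k (suc n) =
    monic-cong (λ x → +-congˡ (*-assoc _ _ _)) (monic-+* (z ^^ suc n) (monic-^* k (monic-geometric z k n)))

  -- Additivity of the Frobenius power maps.

  ·≈·1* : ∀ n x → n · x ≈ (n · 1#) ⊗ x
  ·≈·1* n x = ≈-trans (×-congʳ n (≈-sym (*-identityˡ x))) (≈-sym (×-assoc-* n 1# x))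

  ^·1 : ∀ p n → (p ^ n) · 1# ≈ (p · 1#) ^^ n
  ^·1 p zero    = +-identityʳ 1#
  ^·1 p (suc n) = ≈-trans (×1-homo-* p (p ^ n)) (*-congˡ (^·1 p n))

  AdditivePower : ℕ → Set (c Level.⊔ ℓ)
  AdditivePower n = ∀ x y → (x ⊕ y) ^^ n ≈ x ^^ n ⊕ y ^^ n

  -- In the binomial expansion only the two end terms survive, since `prime∣C` makes every other
  -- coefficient a multiple of `p`.
  frobenius-prime : ∀ {p} → Prim.Prime p → p · 1# ≈ 0# → AdditivePower p
  frobenius-prime {zero}  pr p·1≈0 x y = ⊥-elim (Prim.¬prime[0] pr)
  frobenius-prime {p@(suc p-1)} pr p·1≈0 x y = begin
    (x ⊕ y) ^^ p                                   ≈⟨ theorem p x y ⟩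
    sum term                                       ≈⟨ +-congˡ (sum-init-last (term ∘ suc)) ⟩
    term zero ⊕ (sum middle ⊕ term (suc (Data.Fin.fromℕ p-1)))
      ≈⟨ +-cong first (+-cong middle≈0 last) ⟩
    y ^^ p ⊕ (0# ⊕ x ^^ p)
      ≈⟨ solve 2 (λ a b → a :+ (con 0 :+ b) := b :+ a) ≈-refl (y ^^ p) (x ^^ p) ⟩
    x ^^ p ⊕ y ^^ p                                ∎
    where
    term = binomialTerm x y p
    middle : Fin p-1 → Carrier
    middle i = term (suc (Data.Fin.inject₁ i))
    first : term zero ≈ y ^^ p
    first = ≈-trans (+-identityʳ _) (*-identityˡ _)
    last : term (suc (Data.Fin.fromℕ p-1)) ≈ x ^^ p
    last rewrite Fin.toℕ-fromℕ p-1 | Comb.nCn≡1 p | ℕ.n∸n≡0 p-1 =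
      ≈-trans (+-identityʳ _) (*-identityʳ _)
    middle≈0 : sum middle ≈ 0#
    middle≈0 = ≈-trans (sum-cong-≋ vanish) (sum-replicate-zero p-1)
      where
      vanish : ∀ i → middle i ≈ 0#
      vanish i with prime∣C (suc (toℕ (Data.Fin.inject₁ i))) pr (s≤s z≤n)
                            (s≤s (subst (_< p-1) (sym (Fin.toℕ-inject₁ i)) (Fin.toℕ<n i)))
      ... | Div.divides d eq rewrite eq = begin
        (d * p) · b               ≈⟨ ≈-sym (×-assocˡ b d p) ⟩
        d · (p · b)               ≈⟨ ×-congʳ d (≈-trans (·≈·1* p b) (≈-trans (*-congʳ p·1≈0) (zeroˡ b))) ⟩
        d · 0#                    ≈⟨ ≈-trans (·≈·1* d 0#) (zeroʳ _) ⟩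
        0#                        ∎
        where b = x ^^ suc (toℕ (Data.Fin.inject₁ i)) ⊗ y ^^ (p ∸ suc (toℕ (Data.Fin.inject₁ i)))

  frobenius : ∀ {p} → Prim.Prime p → p · 1# ≈ 0# → ∀ n → AdditivePower (p ^ n)
  frobenius pr p·1≈0 zero    x y = solve 2 (λ x y → (x :+ y) :* con 1 := x :* con 1 :+ y :* con 1) ≈-refl x y
  frobenius {p} pr p·1≈0 (suc n) x y = begin
    (x ⊕ y) ^^ (p * p ^ n)                        ≈⟨ ≈-sym (^-assocʳ (x ⊕ y) p (p ^ n)) ⟩
    ((x ⊕ y) ^^ p) ^^ (p ^ n)                     ≈⟨ ^-congˡ (p ^ n) (frobenius-prime pr p·1≈0 x y) ⟩
    (x ^^ p ⊕ y ^^ p) ^^ (p ^ n)                  ≈⟨ frobenius pr p·1≈0 n (x ^^ p) (y ^^ p) ⟩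
    (x ^^ p) ^^ (p ^ n) ⊕ (y ^^ p) ^^ (p ^ n)     ≈⟨ +-cong (^-assocʳ x p (p ^ n)) (^-assocʳ y p (p ^ n)) ⟩
    x ^^ (p * p ^ n) ⊕ y ^^ (p * p ^ n)           ∎

-- Enumeration of a finite field and of its units.

module FiniteFieldProperties {c ℓ : Level} (N : ℕ) (F : FiniteField c ℓ (suc N)) where
  open FiniteField F
    renaming (_+_ to _⊕_; _*_ to _⊗_; zero to ⊗-zero; refl to ≈-refl; sym to ≈-sym; trans to ≈-trans)
  open FieldProperties fld
  open import Algebra.Properties.CommutativeSemiring.Exp commutativeSemiring
    renaming (_^_ to _^^_)
  open import Algebra.Properties.Semiring.Mult semiring renaming (_×_ to _·_)
  open import Relation.Binary.Reasoning.Setoid setoid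
  import Algebra.Properties.CommutativeMonoid.Sum +-commutativeMonoid as Sum
  import Algebra.Properties.CommutativeMonoid.Sum *-commutativeMonoid as Product

  open Bijection card using (injective) renaming (to to index; cong to index-cong)

  element : Fin (suc N) → Carrier
  element i = proj₁ (Bijection.surjective card i)

  index-element : ∀ i → index (element i) ≡ i
  index-element i = proj₂ (Bijection.surjective card i) ≈-refl

  element-index : ∀ x → element (index x) ≈ x
  element-index x = injective (index-element (index x))

  infix 4 _≟_
  _≟_ : ∀ x y → Dec (x ≈ y)
  x ≟ y = Dec.map′ injective index-cong (index x Fin.≟ index y)

  private
    0ᵢ : Fin (suc N)
    0ᵢ = index 0#

    0ᵢ≢ : ∀ {x} → ¬ x ≈ 0# → 0ᵢ ≢ index x
    0ᵢ≢ x≉0 eq = x≉0 (≈-sym (injective eq))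

  -- Skipping the index of `0#` leaves the nonzero elements, so `N` is the order of the
  -- multiplicative group.
  unit : Fin N → Carrier
  unit j = element (punchIn 0ᵢ j)

  unit-nonzero : ∀ j → ¬ unit j ≈ 0#
  unit-nonzero j eq = Fin.punchInᵢ≢i 0ᵢ j (trans (sym (index-element _)) (index-cong eq))

  unit-distinct : ∀ i j → i ≢ j → ¬ unit i ≈ unit j
  unit-distinct i j i≢j eq = i≢j (Fin.punchIn-injective 0ᵢ i j
    (trans (sym (index-element _)) (trans (index-cong eq) (index-element _))))

  unitIndex : ∀ x → ¬ x ≈ 0# → Fin N
  unitIndex x x≉0 = punchOut (0ᵢ≢ x≉0)

  unit-unitIndex : ∀ x x≉0 → unit (unitIndex x x≉0) ≈ x
  unit-unitIndex x x≉0 rewrite Fin.punchIn-punchOut (0ᵢ≢ x≉0) = element-index x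

  unit-injective : ∀ i j → unit i ≈ unit j → i ≡ j
  unit-injective i j eq with i Fin.≟ j
  ... | yes i≡j = i≡j
  ... | no  i≢j = ⊥-elim (unit-distinct i j i≢j eq)

  -- Counting arguments: characteristic, Fermat's theorem, existence of roots.

  no-small-polynomial : ∀ {n f} → n < N → Monic n f → ¬ (∀ j → f (unit j) ≈ 0#)
  no-small-polynomial n<N (cs , f≈cs) root = ℕ.<⇒≱ n<N
    (root-bound cs unit unit-distinct (λ j → ≈-trans (≈-sym (f≈cs _)) (root j)))

  -- Translation by 1 permutes the field, so the sum of all elements does not change when
  -- `suc N · 1#` is added to it.
  card·1≈0 : suc N · 1# ≈ 0#
  card·1≈0 = +-cancelʳ total (≈-sym (begin
    0# ⊕ total                                     ≈⟨ +-identityˡ total ⟩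
    total                                          ≈⟨ Sum.sum-permute element π ⟩
    Sum.sum (λ i → element (index (1# ⊕ element i))) ≈⟨ Sum.sum-cong-≋ (λ i → element-index (1# ⊕ element i)) ⟩
    Sum.sum (λ i → 1# ⊕ element i)                 ≈⟨ Sum.∑-distrib-+ (λ _ → 1#) element ⟩
    Sum.sum {suc N} (λ _ → 1#) ⊕ total             ≈⟨ +-congʳ (Sum.sum-replicate (suc N)) ⟩
    suc N · 1# ⊕ total                             ∎))
    where
    total = Sum.sum element
    shift : Carrier → Fin (suc N) → Fin (suc N)
    shift a i = index (a ⊕ element i)
    shift-inverse : ∀ a b → a ⊕ b ≈ 0# → ∀ i → shift a (shift b i) ≡ i
    shift-inverse a b a+b≈0 i = trans (index-cong (begin
      a ⊕ element (shift b i)  ≈⟨ +-congˡ (element-index (b ⊕ element i)) ⟩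
      a ⊕ (b ⊕ element i)      ≈⟨ ≈-sym (+-assoc a b _) ⟩
      (a ⊕ b) ⊕ element i      ≈⟨ +-congʳ a+b≈0 ⟩
      0# ⊕ element i           ≈⟨ +-identityˡ _ ⟩
      element i                ∎)) (index-element i)
    π : Permutation′ (suc N)
    π = permutation (shift 1#) (shift (- 1#))
          (shift-inverse 1# (- 1#) (-‿inverseʳ 1#)) (shift-inverse (- 1#) 1# (-‿inverseˡ 1#))

  -- Multiplication by `x` permutes the units; comparing the products of all units before and after
  -- leaves the factor `x ^^ N`.
  fermat : ∀ x → ¬ x ≈ 0# → x ^^ N ≈ 1#
  fermat x x≉0 = *-cancelˡ total≉0 (begin
    total ⊗ x ^^ N                                 ≈⟨ *-comm _ _ ⟩
    x ^^ N ⊗ total                                 ≈⟨ *-congʳ (≈-sym (Product.sum-replicate N)) ⟩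
    Product.sum {N} (λ _ → x) ⊗ total              ≈⟨ ≈-sym (Product.∑-distrib-+ (λ _ → x) unit) ⟩
    Product.sum (λ j → x ⊗ unit j)                 ≈⟨ Product.sum-cong-≋ (≈-sym ∘ unit-scale x x≉0) ⟩
    Product.sum (λ j → unit (scale x x≉0 j))       ≈⟨ ≈-sym (Product.sum-permute unit π) ⟩
    total                                          ≈⟨ ≈-sym (*-identityʳ total) ⟩
    total ⊗ 1#                                     ∎)
    where
    total = Product.sum unit
    product-nonzero : ∀ {n} (f : Fin n → Carrier) → (∀ i → ¬ f i ≈ 0#) → ¬ Product.sum f ≈ 0#
    product-nonzero {zero}  f f≉0 = 0≉1 ∘ ≈-sym
    product-nonzero {suc n} f f≉0 = *-nonzero (f≉0 zero) (product-nonzero (f ∘ suc) (f≉0 ∘ suc))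
    total≉0 : ¬ total ≈ 0#
    total≉0 = product-nonzero unit unit-nonzero
    scale : ∀ a → ¬ a ≈ 0# → Fin N → Fin N
    scale a a≉0 j = unitIndex (a ⊗ unit j) (*-nonzero a≉0 (unit-nonzero j))
    unit-scale : ∀ a a≉0 j → unit (scale a a≉0 j) ≈ a ⊗ unit j
    unit-scale a a≉0 j = unit-unitIndex (a ⊗ unit j) (*-nonzero a≉0 (unit-nonzero j))
    scale-inverse : ∀ a a≉0 b b≉0 → a ⊗ b ≈ 1# → ∀ j → scale a a≉0 (scale b b≉0 j) ≡ j
    scale-inverse a a≉0 b b≉0 ab≈1 j = unit-injective _ _ (begin
      unit (scale a a≉0 (scale b b≉0 j))  ≈⟨ unit-scale a a≉0 _ ⟩
      a ⊗ unit (scale b b≉0 j)            ≈⟨ *-congˡ (unit-scale b b≉0 j) ⟩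
      a ⊗ (b ⊗ unit j)                    ≈⟨ ≈-sym (*-assoc a b _) ⟩
      (a ⊗ b) ⊗ unit j                    ≈⟨ *-congʳ ab≈1 ⟩
      1# ⊗ unit j                         ≈⟨ *-identityˡ _ ⟩
      unit j                              ∎)
    x⁻¹ = proj₁ (inverse x x≉0)
    xx⁻¹≈1 = proj₂ (inverse x x≉0)
    x⁻¹≉0 = factor-nonzeroʳ xx⁻¹≈1
    π : Permutation′ N
    π = permutation (scale x x≉0) (scale x⁻¹ x⁻¹≉0) (scale-inverse x x≉0 x⁻¹ x⁻¹≉0 xx⁻¹≈1)
          (scale-inverse x⁻¹ x⁻¹≉0 x x≉0 (≈-trans (*-comm _ _) xx⁻¹≈1))

  x^card≈x : ∀ x → x ^^ suc N ≈ x
  x^card≈x x with x ≟ 0#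
  ... | yes x≈0 = ≈-trans (≈-trans (*-congʳ x≈0) (zeroˡ _)) (≈-sym x≈0)
  ... | no  x≉0 = ≈-trans (*-congˡ (fermat x x≉0)) (*-identityʳ x)

  -- The `n`-th power of `p · 1#` is the cardinality times 1, hence 0, and a field has no nonzero
  -- nilpotents.
  characteristic : ∀ {p n} → suc N ≡ p ^ n → p · 1# ≈ 0#
  characteristic {p} {n} N+1≡p^n with p · 1# ≟ 0#
  ... | yes eq = eq
  ... | no neq = ⊥-elim (^-nonzero n neq (begin
    (p · 1#) ^^ n   ≈⟨ ≈-sym (^·1 p n) ⟩
    (p ^ n) · 1#    ≡⟨ cong (_· 1#) (sym N+1≡p^n) ⟩
    suc N · 1#      ≈⟨ card·1≈0 ⟩
    0#              ∎))

  -- Fewer than `N` roots cannot cover the `N` units; finiteness and decidable equality turn this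
  -- into a witness.
  ∃-nonroot : ∀ {n f} → n < N → Monic n f → ∃ λ x → ¬ x ≈ 0# × ¬ f x ≈ 0#
  ∃-nonroot {f = f} n<N mf
    with Fin.¬∀⟶∃¬ N _ (λ j → f (unit j) ≟ 0#) (no-small-polynomial n<N mf)
  ... | j , f≉0 = unit j , unit-nonzero j , f≉0

  ∃-^≉1 : ∀ {n} → 0 < n → n < N → ∃ λ x → ¬ x ≈ 0# × ¬ x ^^ n ≈ 1#
  ∃-^≉1 {suc n} _ n<N with ∃-nonroot n<N (monic-+* (- 1#) (monic-^ n))
  ... | x , x≉0 , x^n-1≉0 = x , x≉0 , λ x^n≈1 → x^n-1≉0 (≈-trans (+-congˡ x^n≈1) (-‿inverseˡ 1#))

  -- If no x satisfied xⁿ = z, then (Xⁿᴹ − zᴹ) / (Xⁿ − z), of degree n(M − 1) < N, would vanish on all units.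
  ∃-root : ∀ n M z → N ≡ M * n → z ^^ M ≈ 1# → ∃ λ x → x ^^ n ≈ z
  -- In the two degenerate cases `N` would be 0, although `1#` is a unit.
  ∃-root zero    M       z N≡ zᴹ≈1 =
    ⊥-elim (Fin.¬Fin0 (subst Fin (trans N≡ (ℕ.*-zeroʳ M)) (unitIndex 1# (0≉1 ∘ ≈-sym))))
  ∃-root (suc n) zero    z N≡ zᴹ≈1 = ⊥-elim (Fin.¬Fin0 (subst Fin N≡ (unitIndex 1# (0≉1 ∘ ≈-sym))))
  ∃-root (suc n) (suc M) z N≡ zᴹ≈1 with Fin.any? (λ j → unit j ^^ suc n ≟ z)
  ... | yes (j , xⁿ≈z) = unit j , xⁿ≈z
  ... | no  none       = ⊥-elim (no-small-polynomial
          (subst (M * suc n <_) (sym N≡) (ℕ.m<n+m (M * suc n) (s≤s z≤n)))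
          (monic-geometric z n M)
          (λ j → root (unit j) (unit-nonzero j) (none ∘ (j ,_))))
    where
    root : ∀ x → ¬ x ≈ 0# → ¬ x ^^ suc n ≈ z → geometric z M (x ^^ suc n) ≈ 0#
    root x x≉0 y≉z = xy≈0⇒y≈0 y-z≉0 (begin
      (y ⊕ - z) ⊗ g       ≈⟨ distribʳ g y (- z) ⟩
      y ⊗ g ⊕ - z ⊗ g     ≈⟨ +-congʳ (+-cancelʳ 1# yg+1≈zg+1) ⟩
      z ⊗ g ⊕ - z ⊗ g     ≈⟨ ≈-sym (distribʳ g z (- z)) ⟩
      (z ⊕ - z) ⊗ g       ≈⟨ *-congʳ (-‿inverseʳ z) ⟩
      0# ⊗ g              ≈⟨ zeroˡ g ⟩
      0#                  ∎)
      where
      y = x ^^ suc n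
      g = geometric z M y
      y-z≉0 : ¬ y ⊕ - z ≈ 0#
      y-z≉0 eq = y≉z (+-cancelʳ (- z) (≈-trans eq (≈-sym (-‿inverseʳ z))))
      yᴹ≈1 : y ^^ suc M ≈ 1#
      yᴹ≈1 = begin
        y ^^ suc M              ≈⟨ ^-assocʳ x (suc n) (suc M) ⟩
        x ^^ (suc n * suc M)    ≈⟨ ^-congʳ x (trans (ℕ.*-comm (suc n) (suc M)) (sym N≡)) ⟩
        x ^^ N                  ≈⟨ fermat x x≉0 ⟩
        1#                      ∎
      yg+1≈zg+1 : y ⊗ g ⊕ 1# ≈ z ⊗ g ⊕ 1#
      yg+1≈zg+1 = begin
        y ⊗ g ⊕ 1#            ≈⟨ +-congˡ (≈-sym zᴹ≈1) ⟩
        y ⊗ g ⊕ z ^^ suc M    ≈⟨ geometric-sum z M y ⟩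
        z ⊗ g ⊕ y ^^ suc M    ≈⟨ +-congˡ yᴹ≈1 ⟩
        z ⊗ g ⊕ 1#            ∎

-- Here r = ρ + 1 and t = u + 1, the product `ρ * suc (suc ρ)` is r² - 1, and `M` is (r^t - 1)/(r² -
-- 1). The two strict inequalities provide an element of nonzero trace and an element outside K.
module FrobeniusForms {c ℓ : Level} (N : ℕ) (F : FiniteField c ℓ (suc N)) (ρ u M : ℕ)
  (card≡r^t : suc N ≡ suc ρ ^ suc u)
  (N≡M*[r²-1] : N ≡ M * (ρ * suc (suc ρ)))
  (r^[t-1]<N : suc ρ ^ u < N)
  (r²-1<N : ρ * suc (suc ρ) < N)
  (σ-+ : FieldProperties.AdditivePower (FiniteField.fld F) (suc ρ))
  where
  open FiniteField F
    renaming (_+_ to _⊕_; _*_ to _⊗_; zero to ⊗-zero; refl to ≈-refl; sym to ≈-sym; trans to ≈-trans)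
  open FieldProperties fld
  open FiniteFieldProperties N F
  open import Algebra.Properties.CommutativeSemiring.Exp commutativeSemiring
    using (^-assocʳ; ^-congʳ; ^-congˡ; ^-distrib-*) renaming (_^_ to _^^_)
  open import Algebra.Properties.Ring ring using (-1*x≈-x)
  open import Algebra.Solver.Ring.NaturalCoefficients.Default commutativeSemiring
    using (solve; _:+_; _:*_; _:=_; con)
  open import Relation.Binary.Reasoning.Setoid setoid

  -- The map σ and its fixed subfields.

  r : ℕ
  r = suc ρ

  σ : Carrier → Carrier
  σ x = x ^^ r

  σ-cong : ∀ {x y} → x ≈ y → σ x ≈ σ y
  σ-cong = ^-congˡ r

  σ-* : ∀ x y → σ (x ⊗ y) ≈ σ x ⊗ σ y
  σ-* x y = ^-distrib-* x y r

  σ-0 : σ 0# ≈ 0#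
  σ-0 = 0^suc≈0 ρ

  σ-1 : σ 1# ≈ 1#
  σ-1 = 1^n≈1 r

  σ-nonzero : ∀ {x} → ¬ x ≈ 0# → ¬ σ x ≈ 0#
  σ-nonzero = ^-nonzero r

  σ-^ : ∀ x n → σ (x ^^ (r ^ n)) ≈ x ^^ (r ^ suc n)
  σ-^ x n = ≈-trans (^-assocʳ x (r ^ n) r) (^-congʳ x (ℕ.*-comm (r ^ n) r))

  x^[r^t]≈x : ∀ x → x ^^ (r ^ suc u) ≈ x
  x^[r^t]≈x x = ≈-trans (^-congʳ x (sym card≡r^t)) (x^card≈x x)

  -- The t-th iterate of σ is the identity, so the iterate before it is a right inverse.
  σ-surjective : ∀ y → ∃ λ x → σ x ≈ y
  σ-surjective y = y ^^ (r ^ u) , ≈-trans (σ-^ y u) (x^[r^t]≈x y)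

  -- The subfields with r and with r² elements, as predicates.
  Fixed InK : Carrier → Set ℓ
  Fixed x = σ x ≈ x
  InK x = σ (σ x) ≈ x

  fixed-* : ∀ {x y} → Fixed x → Fixed y → Fixed (x ⊗ y)
  fixed-* fx fy = ≈-trans (σ-* _ _) (*-cong fx fy)

  -- Named so that the semiring solver can treat -1 as a variable; the relation `1+ι≈0` is then
  -- applied by hand.
  ι : Carrier
  ι = - 1#

  1+ι≈0 : 1# ⊕ ι ≈ 0#
  1+ι≈0 = -‿inverseʳ 1#

  fixed-ι : Fixed ι
  fixed-ι = +-cancelʳ 1# (begin
    σ ι ⊕ 1#      ≈⟨ +-congˡ (≈-sym σ-1) ⟩
    σ ι ⊕ σ 1#    ≈⟨ ≈-sym (σ-+ ι 1#) ⟩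
    σ (ι ⊕ 1#)    ≈⟨ σ-cong (-‿inverseˡ 1#) ⟩
    σ 0#          ≈⟨ σ-0 ⟩
    0#            ≈⟨ ≈-sym (-‿inverseˡ 1#) ⟩
    ι ⊕ 1#        ∎)

  inverse-unique : ∀ {x y y′} → x ⊗ y ≈ 1# → x ⊗ y′ ≈ 1# → y ≈ y′
  inverse-unique {x} {y} {y′} xy≈1 xy′≈1 = begin
    y               ≈⟨ ≈-sym (*-identityʳ y) ⟩
    y ⊗ 1#          ≈⟨ *-congˡ (≈-sym xy′≈1) ⟩
    y ⊗ (x ⊗ y′)    ≈⟨ solve 3 (λ x y z → y :* (x :* z) := (x :* y) :* z) ≈-refl x y y′ ⟩
    (x ⊗ y) ⊗ y′    ≈⟨ *-congʳ xy≈1 ⟩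
    1# ⊗ y′         ≈⟨ *-identityˡ y′ ⟩
    y′              ∎

  σ-inverse : ∀ {x y} → x ⊗ y ≈ 1# → σ x ⊗ σ y ≈ 1#
  σ-inverse {x} {y} xy≈1 = ≈-trans (≈-sym (σ-* x y)) (≈-trans (σ-cong xy≈1) σ-1)

  fixed-inverse : ∀ {x y} → x ⊗ y ≈ 1# → Fixed x → Fixed y
  fixed-inverse xy≈1 fx = inverse-unique (≈-trans (*-congʳ (≈-sym fx)) (σ-inverse xy≈1)) xy≈1

  inK-inverse : ∀ {x y} → x ⊗ y ≈ 1# → InK x → InK y
  inK-inverse xy≈1 kx =
    inverse-unique (≈-trans (*-congʳ (≈-sym kx)) (σ-inverse (σ-inverse xy≈1))) xy≈1

  inK-* : ∀ {x y} → InK x → InK y → InK (x ⊗ y)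
  inK-* kx ky = ≈-trans (≈-trans (σ-cong (σ-* _ _)) (σ-* _ _)) (*-cong kx ky)

  -- With one factor `x` split off, membership of a unit in K becomes the equation x^{r²-1} = 1.
  σσ≈^r² : ∀ x → σ (σ x) ≈ x ⊗ x ^^ (ρ * suc r)
  σσ≈^r² x = ≈-trans (^-assocʳ x r r) (^-congʳ x (cong suc (sym (ℕ.*-suc ρ r))))

  -- Non-powers, elements inside and outside K, and the norm.

  private
    N≡Mρ*k : N ≡ M * ρ * suc r
    N≡Mρ*k = trans N≡M*[r²-1] (sym (ℕ.*-assoc M ρ (suc r)))

    0<N : 0 < N
    0<N = ℕ.≤-<-trans z≤n r²-1<N

    0<factor : ∀ m {n} → 0 < m * n → 0 < m
    0<factor (suc m) _ = s≤s z≤n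

    0<Mρ : 0 < M * ρ
    0<Mρ = 0<factor (M * ρ) (subst (0 <_) N≡Mρ*k 0<N)

    Mρ<N : M * ρ < N
    Mρ<N = subst (M * ρ <_) (sym N≡Mρ*k)
      (ℕ.m<m*n (M * ρ) (suc r) {{>-nonZero 0<Mρ}} (s≤s (s≤s z≤n)))

    0<r²-1 : 0 < ρ * suc r
    0<r²-1 = 0<factor (ρ * suc r) (subst (0 <_) (trans N≡M*[r²-1] (ℕ.*-comm M _)) 0<N)

    -- `M * ρ` equals N/(r + 1). The unit `x₀` serves twice: it is not an (r+1)-th power, and its
    -- `M`-th power lies in K without being fixed.
    nonroot = ∃-^≉1 0<Mρ Mρ<N
    x₀ = proj₁ nonroot
    x₀≉0 = proj₁ (proj₂ nonroot)
    x₀^Mρ≉1 = proj₂ (proj₂ nonroot)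

  not-all-powers : ¬ (∀ a → ∃ λ x → x ^^ suc r ≈ a)
  not-all-powers power with power x₀
  ... | y , y^k≈x₀ = x₀^Mρ≉1 (begin
    x₀ ^^ (M * ρ)             ≈⟨ ^-congˡ (M * ρ) (≈-sym y^k≈x₀) ⟩
    (y ^^ suc r) ^^ (M * ρ)   ≈⟨ ^-assocʳ y (suc r) (M * ρ) ⟩
    y ^^ (suc r * (M * ρ))    ≈⟨ ^-congʳ y (trans (ℕ.*-comm (suc r) (M * ρ)) (sym N≡Mρ*k)) ⟩
    y ^^ N
      ≈⟨ fermat y (λ y≈0 → x₀≉0 (≈-trans (≈-sym y^k≈x₀) (≈-trans (*-congʳ y≈0) (zeroˡ _)))) ⟩
    1#                        ∎)

  -- For z = x₀^M, z^{r²-1} = x₀^N = 1 puts z into K, whereas z^{r-1} = x₀^{Mρ} differs from 1.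
  ∃-K∖fixed : ∃ λ z → InK z × ¬ Fixed z
  ∃-K∖fixed = z , kz , λ fz → z^ρ≉1 (*-cancelˡ (^-nonzero M x₀≉0) (≈-trans fz (≈-sym (*-identityʳ z))))
    where
    z = x₀ ^^ M
    z^ρ≉1 : ¬ z ^^ ρ ≈ 1#
    z^ρ≉1 eq = x₀^Mρ≉1 (≈-trans (≈-sym (^-assocʳ x₀ M ρ)) eq)
    kz : InK z
    kz = begin
      σ (σ z)                      ≈⟨ σσ≈^r² z ⟩
      z ⊗ z ^^ (ρ * suc r)         ≈⟨ *-congˡ (^-assocʳ x₀ M (ρ * suc r)) ⟩
      z ⊗ x₀ ^^ (M * (ρ * suc r))  ≈⟨ *-congˡ (^-congʳ x₀ (sym N≡M*[r²-1])) ⟩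
      z ⊗ x₀ ^^ N                  ≈⟨ *-congˡ (fermat x₀ x₀≉0) ⟩
      z ⊗ 1#                       ≈⟨ *-identityʳ z ⟩
      z                            ∎

  ∃-∉K : ∃ λ z → ¬ InK z
  ∃-∉K with ∃-^≉1 0<r²-1 r²-1<N
  ... | z , z≉0 , z^≉1 = z , λ kz →
    z^≉1 (*-cancelˡ z≉0 (≈-trans (≈-sym (σσ≈^r² z)) (≈-trans kz (≈-sym (*-identityʳ z)))))

  -- For nonzero `b`, b^{r-1} = 1 implies b^{N/(r+1)} = 1, so `∃-root` gives `y` with yσy = b. As b
  -- is fixed, σy·σσy = yσy, and cancelling σy puts y into K.
  norm-surjective : ∀ b → Fixed b → ∃ λ c → c ⊗ σ c ≈ b × InK c
  norm-surjective b fb with b ≟ 0#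
  ... | yes b≈0 = 0# , ≈-trans (zeroˡ _) (≈-sym b≈0) , ≈-trans (σ-cong σ-0) σ-0
  ... | no  b≉0 = y , N[y]≈b , *-cancelˡ (σ-nonzero y≉0) (begin
    σ y ⊗ σ (σ y)   ≈⟨ ≈-sym (σ-* y (σ y)) ⟩
    σ (y ⊗ σ y)     ≈⟨ σ-cong N[y]≈b ⟩
    σ b             ≈⟨ ≈-trans fb (≈-sym N[y]≈b) ⟩
    y ⊗ σ y         ≈⟨ *-comm y (σ y) ⟩
    σ y ⊗ y         ∎)
    where
    b^ρ≈1 : b ^^ ρ ≈ 1#
    b^ρ≈1 = *-cancelˡ b≉0 (≈-trans fb (≈-sym (*-identityʳ b)))
    b^Mρ≈1 : b ^^ (M * ρ) ≈ 1#
    b^Mρ≈1 = ≈-trans (^-congʳ b (ℕ.*-comm M ρ))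
      (≈-trans (≈-sym (^-assocʳ b ρ M)) (≈-trans (^-congˡ M b^ρ≈1) (1^n≈1 M)))
    root = ∃-root (suc r) (M * ρ) b N≡Mρ*k b^Mρ≈1
    y = proj₁ root
    N[y]≈b : y ⊗ σ y ≈ b
    N[y]≈b = proj₂ root
    y≉0 : ¬ y ≈ 0#
    y≉0 y≈0 = b≉0 (≈-trans (≈-sym N[y]≈b) (≈-trans (*-congʳ y≈0) (zeroˡ _)))

  -- Congruence modulo the subgroup I.

  infix 4 _∼_
  -- This is x - y = w - σw, membership of the difference in I, freed of subtraction.
  _∼_ : Carrier → Carrier → Set _
  x ∼ y = ∃ λ w → x ⊕ σ w ≈ y ⊕ w

  ≈⇒∼ : ∀ {x y} → x ≈ y → x ∼ y
  ≈⇒∼ x≈y = 0# , +-cong x≈y σ-0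

  x∼σx : ∀ x → x ∼ σ x
  x∼σx x = x , +-comm x (σ x)

  ∼-+ : ∀ {x y x′ y′} → x ∼ y → x′ ∼ y′ → x ⊕ x′ ∼ y ⊕ y′
  ∼-+ {x} {y} {x′} {y′} (w , e) (w′ , e′) = w ⊕ w′ , (begin
    (x ⊕ x′) ⊕ σ (w ⊕ w′)        ≈⟨ +-congˡ (σ-+ w w′) ⟩
    (x ⊕ x′) ⊕ (σ w ⊕ σ w′)      ≈⟨ interchange x x′ (σ w) (σ w′) ⟩
    (x ⊕ σ w) ⊕ (x′ ⊕ σ w′)      ≈⟨ +-cong e e′ ⟩
    (y ⊕ w) ⊕ (y′ ⊕ w′)          ≈⟨ interchange y w y′ w′ ⟩
    (y ⊕ y′) ⊕ (w ⊕ w′)          ∎)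
    where
    interchange : ∀ a b c d → (a ⊕ b) ⊕ (c ⊕ d) ≈ (a ⊕ c) ⊕ (b ⊕ d)
    interchange = solve 4 (λ a b c d → (a :+ b) :+ (c :+ d) := (a :+ c) :+ (b :+ d)) ≈-refl

  ∼-scale : ∀ {b x y} → Fixed b → x ∼ y → b ⊗ x ∼ b ⊗ y
  ∼-scale {b} {x} {y} fb (w , e) = b ⊗ w , (begin
    b ⊗ x ⊕ σ (b ⊗ w)     ≈⟨ +-congˡ (≈-trans (σ-* b w) (*-congʳ fb)) ⟩
    b ⊗ x ⊕ b ⊗ σ w       ≈⟨ ≈-sym (distribˡ b x (σ w)) ⟩
    b ⊗ (x ⊕ σ w)         ≈⟨ *-congˡ e ⟩
    b ⊗ (y ⊕ w)           ≈⟨ distribˡ b y w ⟩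
    b ⊗ y ⊕ b ⊗ w         ∎)

  x+ιx≈0 : ∀ x → x ⊕ ι ⊗ x ≈ 0#
  x+ιx≈0 x = ≈-trans (+-congˡ (-1*x≈-x x)) (-‿inverseʳ x)

  ∼-resp : ∀ {x x′ y y′} → x ≈ x′ → y ≈ y′ → x ∼ y → x′ ∼ y′
  ∼-resp x≈ y≈ (w , e) = w , ≈-trans (+-congʳ (≈-sym x≈)) (≈-trans e (+-congʳ y≈))

  -- The second congruence, scaled by the fixed element ι, is added to the first. Symmetry and
  -- transitivity are special cases.
  ∼-cancelʳ : ∀ {x y z w} → x ⊕ z ∼ y ⊕ w → z ∼ w → x ∼ y
  ∼-cancelʳ {x} {y} {z} {w} e e′ =
    ∼-resp (simplify x z) (simplify y w) (∼-+ e (∼-scale fixed-ι e′))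
    where
    simplify : ∀ x z → (x ⊕ z) ⊕ ι ⊗ z ≈ x
    simplify x z = ≈-trans (+-assoc x z _) (≈-trans (+-congˡ (x+ιx≈0 z)) (+-identityʳ x))

  ∼-sym : ∀ {x y} → x ∼ y → y ∼ x
  ∼-sym {x} {y} e = ∼-cancelʳ (≈⇒∼ (+-comm y x)) e

  ∼-trans : ∀ {x y z} → x ∼ y → y ∼ z → x ∼ z
  ∼-trans {x} {y} {z} e e′ = ∼-cancelʳ (∼-resp ≈-refl (+-comm y z) (∼-+ e e′)) (≈⇒∼ ≈-refl)

  ∼-unscale : ∀ {b x y} → Fixed b → ¬ b ≈ 0# → b ⊗ x ∼ b ⊗ y → x ∼ y
  ∼-unscale {b} {x} {y} fb b≉0 e with inverse b b≉0
  ... | b⁻¹ , bb⁻¹≈1 = ∼-resp (simplify x) (simplify y) (∼-scale (fixed-inverse bb⁻¹≈1 fb) e)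
    where
    simplify : ∀ x → b⁻¹ ⊗ (b ⊗ x) ≈ x
    simplify x = ≈-trans (≈-sym (*-assoc b⁻¹ b x))
      (≈-trans (*-congʳ (≈-trans (*-comm b⁻¹ b) bb⁻¹≈1)) (*-identityˡ x))

  ∼-unscale-0 : ∀ {b x} → Fixed b → ¬ b ≈ 0# → b ⊗ x ∼ 0# → x ∼ 0#
  ∼-unscale-0 fb b≉0 e = ∼-unscale fb b≉0 (∼-resp ≈-refl (≈-sym (zeroʳ _)) e)

  -- The trace and the quotient by I.

  tr : ℕ → Carrier → Carrier
  tr zero    x = 0#
  tr (suc n) x = x ^^ (r ^ n) ⊕ tr n x

  -- The definition of `tr` splits off the highest conjugate, this recursion the lowest; comparing
  -- the two at n = t shows that the trace is fixed by σ.
  tr-suc : ∀ n x → tr (suc n) x ≈ x ⊕ σ (tr n x)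
  tr-suc zero    x = +-cong (*-identityʳ x) (≈-sym σ-0)
  tr-suc (suc n) x = begin
    x ^^ (r ^ suc n) ⊕ tr (suc n) x             ≈⟨ +-cong (≈-sym (σ-^ x n)) (tr-suc n x) ⟩
    σ (x ^^ (r ^ n)) ⊕ (x ⊕ σ (tr n x))
      ≈⟨ solve 3 (λ a b c → a :+ (b :+ c) := b :+ (a :+ c)) ≈-refl _ x _ ⟩
    x ⊕ (σ (x ^^ (r ^ n)) ⊕ σ (tr n x))         ≈⟨ +-congˡ (≈-sym (σ-+ _ _)) ⟩
    x ⊕ σ (x ^^ (r ^ n) ⊕ tr n x)               ∎

  trace : Carrier → Carrier
  trace = tr (suc u)

  fixed-trace : ∀ x → Fixed (trace x)
  fixed-trace x = +-cancelʳ x (begin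
    σ (trace x) ⊕ x              ≈⟨ +-comm _ x ⟩
    x ⊕ σ (trace x)              ≈⟨ ≈-sym (tr-suc (suc u) x) ⟩
    x ^^ (r ^ suc u) ⊕ trace x   ≈⟨ +-congʳ (x^[r^t]≈x x) ⟩
    x ⊕ trace x                  ≈⟨ +-comm x _ ⟩
    trace x ⊕ x                  ∎)

  -- Since σ preserves classes, σⁿz·σⁱθ is congruent to σⁿ⁻ⁱz·θ; the terms with i < n add up to the
  -- right-hand side.
  tr-swap : ∀ n z θ → z ^^ (r ^ n) ⊗ tr n θ ∼ θ ⊗ σ (tr n z)
  tr-swap zero    z θ = ≈⇒∼ (≈-trans (zeroʳ _) (≈-sym (≈-trans (*-congˡ σ-0) (zeroʳ _))))
  tr-swap (suc n) z θ = ∼-resp (≈-sym left) (≈-sym right)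
    (∼-+ (≈⇒∼ ≈-refl) (∼-trans (∼-sym (x∼σx (zₙ ⊗ tr n θ))) (tr-swap n z θ)))
    where
    zₙ = z ^^ (r ^ n)
    left : z ^^ (r ^ suc n) ⊗ tr (suc n) θ ≈ θ ⊗ σ zₙ ⊕ σ (zₙ ⊗ tr n θ)
    left = begin
      z ^^ (r ^ suc n) ⊗ tr (suc n) θ   ≈⟨ *-cong (≈-sym (σ-^ z n)) (tr-suc n θ) ⟩
      σ zₙ ⊗ (θ ⊕ σ (tr n θ))
        ≈⟨ solve 3 (λ a b c → a :* (b :+ c) := b :* a :+ a :* c) ≈-refl (σ zₙ) θ _ ⟩
      θ ⊗ σ zₙ ⊕ σ zₙ ⊗ σ (tr n θ)      ≈⟨ +-congˡ (≈-sym (σ-* zₙ (tr n θ))) ⟩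
      θ ⊗ σ zₙ ⊕ σ (zₙ ⊗ tr n θ)        ∎
    right : θ ⊗ σ (tr (suc n) z) ≈ θ ⊗ σ zₙ ⊕ θ ⊗ σ (tr n z)
    right = ≈-trans (*-congˡ (σ-+ zₙ (tr n z))) (distribˡ θ _ _)

  trace-swap : ∀ z θ → z ⊗ trace θ ∼ θ ⊗ trace z
  trace-swap z θ = ∼-resp (*-congʳ (x^[r^t]≈x z)) (*-congˡ (fixed-trace z)) (tr-swap (suc u) z θ)

  -- The trace is a monic polynomial of degree r^{t-1}, which is less than `N`.
  ∃-trace≉0 : 1 < r → ∃ λ θ → ¬ trace θ ≈ 0#
  ∃-trace≉0 1<r with ∃-nonroot r^[t-1]<N (monic u ℕ.≤-refl)
    where
    monic : ∀ n → n ≤ u → Monic (r ^ u) (λ x → x ^^ (r ^ u) ⊕ tr n x)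
    monic zero    n≤u = monic-cong (λ x → +-identityʳ _) (monic-^ (r ^ u))
    monic (suc n) n<u = monic-cong
      (λ x → solve 3 (λ a b c → a :+ (b :+ c) := b :+ (a :+ c)) ≈-refl _ _ _)
      (monic-+^ (r ^ n) (ℕ.^-monoʳ-< r 1<r n<u) (monic n (ℕ.<⇒≤ n<u)))
  ... | θ , _ , Tθ≉0 = θ , Tθ≉0

  -- Additive Hilbert 90: for θ of nonzero trace, a·Tr θ is congruent to θ·Tr a = 0, and the fixed
  -- factor Tr θ can be divided out.
  trace≈0⇒∼0 : 1 < r → ∀ {a} → trace a ≈ 0# → a ∼ 0#
  trace≈0⇒∼0 1<r {a} Ta≈0 with ∃-trace≉0 1<r
  ... | θ , Tθ≉0 = ∼-unscale-0 (fixed-trace θ) Tθ≉0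
    (∼-resp (*-comm _ _) (≈-trans (*-congˡ Ta≈0) (zeroʳ θ)) (trace-swap a θ))

  -- Dividing `trace-swap` by Tr a gives e = Tr b / Tr a, so the class of `a` spans the quotient by
  -- I over the fixed field.
  ∼-multiple : ∀ {a} → ¬ trace a ≈ 0# → ∀ b → ∃ λ e → Fixed e × b ∼ e ⊗ a
  ∼-multiple {a} Ta≉0 b with inverse (trace a) Ta≉0
  ... | τ , Ta*τ≈1 = τ ⊗ trace b , fixed-* fτ (fixed-trace b) ,
    ∼-resp left right (∼-scale fτ (trace-swap b a))
    where
    fτ = fixed-inverse Ta*τ≈1 (fixed-trace a)
    left : τ ⊗ (b ⊗ trace a) ≈ b
    left = begin
      τ ⊗ (b ⊗ trace a)     ≈⟨ solve 3 (λ t b x → t :* (b :* x) := b :* (x :* t)) ≈-refl τ b (trace a) ⟩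
      b ⊗ (trace a ⊗ τ)     ≈⟨ *-congˡ Ta*τ≈1 ⟩
      b ⊗ 1#                ≈⟨ *-identityʳ b ⟩
      b                     ∎
    right : τ ⊗ (a ⊗ trace b) ≈ (τ ⊗ trace b) ⊗ a
    right = solve 3 (λ t a x → t :* (a :* x) := (t :* x) :* a) ≈-refl τ a (trace b)

  -- Isotropic vectors of the Hermitian form.

  inK⇒fixed-x+σx : ∀ {d} → InK d → Fixed (d ⊕ σ d)
  inK⇒fixed-x+σx {d} kd = ≈-trans (σ-+ d (σ d)) (≈-trans (+-congˡ kd) (+-comm (σ d) d))

  x+y≈0∧2≈0⇒x≈y : ∀ {x y} → x ⊕ y ≈ 0# → 1# ⊕ 1# ≈ 0# → x ≈ y
  x+y≈0∧2≈0⇒x≈y {x} {y} x+y≈0 2≈0 = +-cancelʳ y (begin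
    x ⊕ y             ≈⟨ x+y≈0 ⟩
    0#                ≈⟨ ≈-sym (zeroˡ y) ⟩
    0# ⊗ y            ≈⟨ *-congʳ (≈-sym 2≈0) ⟩
    (1# ⊕ 1#) ⊗ y     ≈⟨ solve 1 (λ y → (con 1 :+ con 1) :* y := y :+ y) ≈-refl y ⟩
    y ⊕ y             ∎)

  -- This covers every characteristic: if z + σz = 0 then d = 1 works, because 2 = 0 would turn that
  -- equation into σz = z.
  K∖fixed⇒trace≉0 : ∀ z → InK z → ¬ Fixed z → ∃ λ d → InK d × ¬ d ⊕ σ d ≈ 0#
  K∖fixed⇒trace≉0 z kz ¬fz with z ⊕ σ z ≟ 0#
  ... | no  neq = z , kz , neq
  ... | yes eq  = 1# , ≈-trans (σ-cong σ-1) σ-1 , λ 1+σ1≈0 →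
    ¬fz (≈-sym (x+y≈0∧2≈0⇒x≈y eq (≈-trans (+-congˡ (≈-sym σ-1)) 1+σ1≈0)))

  -- Applying σ to σd·a gives d·σa, as d lies in K. Hence d(a + σa) is congruent to (d + σd)a, whose
  -- first factor is fixed and nonzero.
  isotropic-1 : ∀ {a d} → InK d → ¬ d ⊕ σ d ≈ 0# → d ⊗ (a ⊕ σ a) ∼ 0# → a ∼ 0#
  isotropic-1 {a} {d} kd d+σd≉0 e = ∼-unscale-0 (inK⇒fixed-x+σx kd) d+σd≉0
    (∼-resp (≈-sym (distribʳ a d (σ d))) ≈-refl
      (∼-trans (∼-+ (≈⇒∼ ≈-refl) σda∼dσa) (∼-resp (distribˡ d a (σ a)) ≈-refl e)))
    where
    σda∼dσa : σ d ⊗ a ∼ d ⊗ σ a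
    σda∼dσa = ∼-resp ≈-refl (≈-trans (σ-* (σ d) a) (*-congʳ kd)) (x∼σx (σ d ⊗ a))

  -- Here y = z - σσz, so dy = dz - σσ(dz) for d in K, and σσ preserves classes. Thus the whole
  -- K-line through `y` lies in I.
  K-multiple∼0 : ∀ {y z d} → y ⊕ σ (σ z) ≈ z → InK d → d ⊗ y ∼ 0#
  K-multiple∼0 {y} {z} {d} y+σσz≈z kd = ∼-cancelʳ
    (≈⇒∼ (begin
      d ⊗ y ⊕ σ (σ (d ⊗ z))       ≈⟨ +-congˡ (≈-trans (σ-cong (σ-* d z)) (≈-trans (σ-* _ _) (*-congʳ kd))) ⟩
      d ⊗ y ⊕ d ⊗ σ (σ z)         ≈⟨ ≈-sym (distribˡ d y _) ⟩
      d ⊗ (y ⊕ σ (σ z))           ≈⟨ *-congˡ y+σσz≈z ⟩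
      d ⊗ z                       ≈⟨ ≈-sym (+-identityˡ _) ⟩
      0# ⊕ d ⊗ z                  ∎))
    (∼-sym (∼-trans (x∼σx (d ⊗ z)) (x∼σx _)))


  Isotropic : Carrier → Set _
  Isotropic a = ∃ λ s → ¬ s ≈ 0# × a ⊗ (s ⊗ σ s) ∼ 0#

  ∼0⇒isotropic : ∀ {a} → a ∼ 0# → Isotropic a
  ∼0⇒isotropic {a} a∼0 = 1# , 0≉1 ∘ ≈-sym , ∼-resp (≈-sym a*N[1]≈a) ≈-refl a∼0
    where
    a*N[1]≈a : a ⊗ (1# ⊗ σ 1#) ≈ a
    a*N[1]≈a = ≈-trans (*-congˡ (≈-trans (*-identityˡ _) σ-1)) (*-identityʳ a)

  -- The cross terms of a(e + w)^{r+1} for e ∈ K are congruent to e w^r (a + aʳ).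
  isotropic-sum : ∀ {a b e w y} → InK e → e ⊗ σ e ≈ ι ⊗ b → a ⊗ (w ⊗ σ w) ∼ b ⊗ a →
    σ w ⊗ (a ⊕ σ a) ≈ y → e ⊗ y ∼ 0# → a ⊗ ((e ⊕ w) ⊗ σ (e ⊕ w)) ∼ 0#
  isotropic-sum {a} {b} {e} {w} {y} ke N[e]≈-b aN[w]∼ba y≈ ey∼0 =
    ∼-resp (≈-sym expand) sum≈0
      (∼-+ (∼-+ (≈⇒∼ (*-congˡ N[e]≈-b)) aN[w]∼ba)
        (∼-trans (∼-+ (≈⇒∼ ≈-refl) awσe∼eσaσw) (∼-resp (≈-sym cross) ≈-refl ey∼0)))
    where
    expand : a ⊗ ((e ⊕ w) ⊗ σ (e ⊕ w)) ≈
             (a ⊗ (e ⊗ σ e) ⊕ a ⊗ (w ⊗ σ w)) ⊕ (a ⊗ (e ⊗ σ w) ⊕ a ⊗ (w ⊗ σ e))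
    expand = ≈-trans (*-congˡ (*-congˡ (σ-+ e w)))
      (solve 5 (λ a e w e′ w′ → a :* ((e :+ w) :* (e′ :+ w′)) :=
         (a :* (e :* e′) :+ a :* (w :* w′)) :+ (a :* (e :* w′) :+ a :* (w :* e′)))
         ≈-refl a e w (σ e) (σ w))
    awσe∼eσaσw : a ⊗ (w ⊗ σ e) ∼ σ a ⊗ (σ w ⊗ e)
    awσe∼eσaσw = ∼-resp ≈-refl
      (≈-trans (σ-* a _) (*-congˡ (≈-trans (σ-* w (σ e)) (*-congˡ ke)))) (x∼σx (a ⊗ (w ⊗ σ e)))
    cross : a ⊗ (e ⊗ σ w) ⊕ σ a ⊗ (σ w ⊗ e) ≈ e ⊗ y
    cross = ≈-trans
      (solve 4 (λ a a′ e w′ → a :* (e :* w′) :+ a′ :* (w′ :* e) := e :* (w′ :* (a :+ a′)))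
        ≈-refl a (σ a) e (σ w))
      (*-congˡ y≈)
    sum≈0 : (a ⊗ (ι ⊗ b) ⊕ b ⊗ a) ⊕ 0# ≈ 0#
    sum≈0 = ≈-trans
      (solve 3 (λ a b i → (a :* (i :* b) :+ b :* a) :+ con 0 := (con 1 :+ i) :* (a :* b)) ≈-refl a b ι)
      (≈-trans (*-congʳ 1+ι≈0) (zeroˡ _))

  InK-− : ∀ {x y} → InK x → x ⊕ y ≈ 0# → InK y
  InK-− {x} {y} kx x+y≈0 = +-cancelʳ x (begin
    σ (σ y) ⊕ x            ≈⟨ +-congˡ (≈-sym kx) ⟩
    σ (σ y) ⊕ σ (σ x)      ≈⟨ ≈-sym (≈-trans (σ-cong (σ-+ y x)) (σ-+ _ _)) ⟩
    σ (σ (y ⊕ x))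
      ≈⟨ ≈-trans (σ-cong (σ-cong (≈-trans (+-comm y x) x+y≈0))) (≈-trans (σ-cong σ-0) σ-0) ⟩
    0#                     ≈⟨ ≈-sym (≈-trans (+-comm y x) x+y≈0) ⟩
    y ⊕ x                  ∎)

  -- The vector `w` is orthogonal to K. The form takes the value b·a at w for a fixed `b`, and `e`
  -- in K of norm -b cancels it; e + w is nonzero because w is outside K.
  isotropic-∉K : ∀ {a w y} → ¬ trace a ≈ 0# → ¬ InK w → σ w ⊗ (a ⊕ σ a) ≈ y →
    (∀ {e} → InK e → e ⊗ y ∼ 0#) → Isotropic a
  isotropic-∉K {a} {w} Ta≉0 ¬kw y≈ Ky∼0 =
    let b , fb , aN[w]∼ba = ∼-multiple Ta≉0 (a ⊗ (w ⊗ σ w))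
        e , N[e]≈-b , ke  = norm-surjective (ι ⊗ b) (fixed-* fixed-ι fb)
    in e ⊕ w , ¬kw ∘ InK-− ke , isotropic-sum ke N[e]≈-b aN[w]∼ba y≈ (Ky∼0 ke)

  -- If `w` is in K, then so is d/σw, and multiplying `y` by it puts d(a + σa) into I. By
  -- `isotropic-1` the vector 1 is then isotropic.
  isotropic-∈K : ∀ {a w y d} → InK d → ¬ d ⊕ σ d ≈ 0# → ¬ y ≈ 0# → InK w → σ w ⊗ (a ⊕ σ a) ≈ y →
    (∀ {e} → InK e → e ⊗ y ∼ 0#) → Isotropic a
  isotropic-∈K {a} {w} {y} {d} kd d+σd≉0 y≉0 kw y≈ Ky∼0 =
    let v , σw*v≈1 = inverse (σ w) σw≉0 in
    ∼0⇒isotropic (isotropic-1 kd d+σd≉0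
      (∼-resp (simplify v σw*v≈1) ≈-refl (Ky∼0 (inK-* kd (inK-inverse σw*v≈1 (σ-cong kw))))))
    where
    σw≉0 : ¬ σ w ≈ 0#
    σw≉0 eq = y≉0 (≈-trans (≈-sym y≈) (≈-trans (*-congʳ eq) (zeroˡ _)))
    simplify : ∀ v → σ w ⊗ v ≈ 1# → (d ⊗ v) ⊗ y ≈ d ⊗ (a ⊕ σ a)
    simplify v σw*v≈1 = begin
      (d ⊗ v) ⊗ y                      ≈⟨ *-congˡ (≈-sym y≈) ⟩
      (d ⊗ v) ⊗ (σ w ⊗ (a ⊕ σ a))
        ≈⟨ solve 4 (λ d v w x → (d :* v) :* (w :* x) := (w :* v) :* (d :* x)) ≈-refl d v (σ w) (a ⊕ σ a) ⟩
      (σ w ⊗ v) ⊗ (d ⊗ (a ⊕ σ a))      ≈⟨ ≈-trans (*-congʳ σw*v≈1) (*-identityˡ _) ⟩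
      d ⊗ (a ⊕ σ a)                    ∎

  isotropic : 1 < r → ∀ {d z y} → InK d → ¬ d ⊕ σ d ≈ 0# → ¬ y ≈ 0# → y ⊕ σ (σ z) ≈ z →
    ∀ a → Isotropic a
  isotropic 1<r {d} {z} {y} kd d+σd≉0 y≉0 y+σσz≈z a with trace a ≟ 0#
  ... | yes Ta≈0 = ∼0⇒isotropic (trace≈0⇒∼0 1<r Ta≈0)
  ... | no  Ta≉0 with (a ⊕ σ a) ≟ 0#
  ...   | yes a+σa≈0 = ∼0⇒isotropic (isotropic-1 kd d+σd≉0 (≈⇒∼ (≈-trans (*-congˡ a+σa≈0) (zeroʳ d))))
  ...   | no  a+σa≉0 =
    -- Solving σw·(a + σa) = y turns the cross terms of `w` with e in K into e·y, which lies in I.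
    let v , [a+σa]v≈1 = inverse (a ⊕ σ a) a+σa≉0
        w , σw≈       = σ-surjective (y ⊗ v)
    in by-membership w (simplify v w [a+σa]v≈1 σw≈)
    where
    simplify : ∀ v w → (a ⊕ σ a) ⊗ v ≈ 1# → σ w ≈ y ⊗ v → σ w ⊗ (a ⊕ σ a) ≈ y
    simplify v w [a+σa]v≈1 σw≈ = begin
      σ w ⊗ (a ⊕ σ a)          ≈⟨ *-congʳ σw≈ ⟩
      (y ⊗ v) ⊗ (a ⊕ σ a)      ≈⟨ solve 3 (λ y v x → (y :* v) :* x := y :* (x :* v)) ≈-refl y v (a ⊕ σ a) ⟩
      y ⊗ ((a ⊕ σ a) ⊗ v)      ≈⟨ ≈-trans (*-congˡ [a+σa]v≈1) (*-identityʳ y) ⟩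
      y                        ∎
    by-membership : ∀ w → σ w ⊗ (a ⊕ σ a) ≈ y → Isotropic a
    by-membership w y≈ with σ (σ w) ≟ w
    ... | yes kw = isotropic-∈K kd d+σd≉0 y≉0 kw y≈ (K-multiple∼0 y+σσz≈z)
    ... | no ¬kw = isotropic-∉K Ta≉0 ¬kw y≈ (K-multiple∼0 y+σσz≈z)

  -- Sums of two norms.

  -- With N j = −1, the sum of the norms of 1 + z w and j (1 + σz w) is (z − σz)(w − σw);
  -- both are divided by s to adjust w − σw to the prescribed value.
  sum-of-norms : ∀ {j z} → j ⊗ σ j ≈ ι → InK z → ¬ Fixed z → (∀ b → Isotropic b) →
    ∀ a → ∃ λ x → ∃ λ y → x ⊗ σ x ⊕ y ⊗ σ y ≈ a
  sum-of-norms {j} {z} N[j]≈-1 kz ¬fz isotropic a =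
    let κ⁻¹ , κκ⁻¹≈1          = inverse κ κ≉0
        -- The congruence to 0 itself carries the `w` with w - σw = κ⁻¹·a·s^{r+1}.
        s , s≉0 , w , e       = isotropic (κ⁻¹ ⊗ a)
        g , sg≈1              = inverse s s≉0
    in g ⊗ (1# ⊕ z ⊗ w) , j ⊗ (g ⊗ (1# ⊕ σ z ⊗ w)) ,
       identity (κ⁻¹ ⊗ a) s w g
         (≈-trans (≈-sym (*-assoc κ κ⁻¹ a)) (≈-trans (*-congʳ κκ⁻¹≈1) (*-identityˡ a)))
         (≈-trans (≈-sym (+-identityˡ w)) (≈-sym e)) sg≈1
    where
    κ = z ⊕ ι ⊗ σ z
    κ≉0 : ¬ κ ≈ 0#
    κ≉0 κ≈0 = ¬fz (≈-sym (+-cancelʳ (ι ⊗ σ z) (≈-trans κ≈0 (≈-sym (x+ιx≈0 (σ z))))))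
    identity : ∀ b s w g → κ ⊗ b ≈ a → w ≈ b ⊗ (s ⊗ σ s) ⊕ σ w → s ⊗ g ≈ 1# →
      (g ⊗ (1# ⊕ z ⊗ w)) ⊗ σ (g ⊗ (1# ⊕ z ⊗ w)) ⊕
      (j ⊗ (g ⊗ (1# ⊕ σ z ⊗ w))) ⊗ σ (j ⊗ (g ⊗ (1# ⊕ σ z ⊗ w))) ≈ a
    identity b s w g κb≈a w≈ sg≈1 = begin
      (g ⊗ (1# ⊕ z ⊗ w)) ⊗ σ (g ⊗ (1# ⊕ z ⊗ w)) ⊕
      (j ⊗ (g ⊗ (1# ⊕ z′ ⊗ w))) ⊗ σ (j ⊗ (g ⊗ (1# ⊕ z′ ⊗ w)))
        ≈⟨ +-cong (*-congˡ (σ-affine z w))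
             (*-congˡ (≈-trans (σ-* j _) (*-congˡ (≈-trans (σ-affine z′ w) (*-congˡ (+-congˡ (*-congʳ kz))))))) ⟩
      (g ⊗ (1# ⊕ z ⊗ w)) ⊗ (g′ ⊗ (1# ⊕ z′ ⊗ w′)) ⊕
      (j ⊗ (g ⊗ (1# ⊕ z′ ⊗ w))) ⊗ (σ j ⊗ (g′ ⊗ (1# ⊕ z ⊗ w′)))
        ≈⟨ solve 8 (λ g g′ z z′ w w′ j j′ →
             (g :* (con 1 :+ z :* w)) :* (g′ :* (con 1 :+ z′ :* w′)) :+
             (j :* (g :* (con 1 :+ z′ :* w))) :* (j′ :* (g′ :* (con 1 :+ z :* w′))) :=
             (g :* g′) :* ((con 1 :+ z :* w) :* (con 1 :+ z′ :* w′) :+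
             (j :* j′) :* ((con 1 :+ z′ :* w) :* (con 1 :+ z :* w′))))
             ≈-refl g g′ z z′ w w′ j (σ j) ⟩
      (g ⊗ g′) ⊗ ((1# ⊕ z ⊗ w) ⊗ (1# ⊕ z′ ⊗ w′) ⊕ (j ⊗ σ j) ⊗ ((1# ⊕ z′ ⊗ w) ⊗ (1# ⊕ z ⊗ w′)))
        ≈⟨ *-congˡ (+-congˡ (*-congʳ N[j]≈-1)) ⟩
      (g ⊗ g′) ⊗ ((1# ⊕ z ⊗ w) ⊗ (1# ⊕ z′ ⊗ w′) ⊕ ι ⊗ ((1# ⊕ z′ ⊗ w) ⊗ (1# ⊕ z ⊗ w′)))
        ≈⟨ *-congˡ (solve 5 (λ z z′ w w′ i →
             (con 1 :+ z :* w) :* (con 1 :+ z′ :* w′) :+ i :* ((con 1 :+ z′ :* w) :* (con 1 :+ z :* w′)) :=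
             (con 1 :+ i) :* (con 1 :+ (z :* z′) :* (w :* w′)) :+ ((z :+ i :* z′) :* w :+ (z′ :* w′ :+ i :* (z :* w′))))
             ≈-refl z z′ w w′ ι) ⟩
      (g ⊗ g′) ⊗ ((1# ⊕ ι) ⊗ A ⊕ (κ ⊗ w ⊕ (z′ ⊗ w′ ⊕ ι ⊗ (z ⊗ w′))))
        ≈⟨ *-congˡ (+-congˡ (+-congʳ (*-congˡ w≈))) ⟩
      (g ⊗ g′) ⊗ ((1# ⊕ ι) ⊗ A ⊕ (κ ⊗ (b ⊗ (s ⊗ σ s) ⊕ w′) ⊕ (z′ ⊗ w′ ⊕ ι ⊗ (z ⊗ w′))))
        -- The term κw′ and the other terms linear in w′ combine to (1 + ι)(z + z′)w′, which
        -- vanishes.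
        ≈⟨ *-congˡ (solve 7 (λ z z′ w′ i A b S →
             (con 1 :+ i) :* A :+ ((z :+ i :* z′) :* (b :* S :+ w′) :+ (z′ :* w′ :+ i :* (z :* w′))) :=
             (con 1 :+ i) :* (A :+ (z :+ z′) :* w′) :+ ((z :+ i :* z′) :* b) :* S)
             ≈-refl z z′ w′ ι A b (s ⊗ σ s)) ⟩
      (g ⊗ g′) ⊗ ((1# ⊕ ι) ⊗ (A ⊕ (z ⊕ z′) ⊗ w′) ⊕ (κ ⊗ b) ⊗ (s ⊗ σ s))
        ≈⟨ *-congˡ (+-cong (≈-trans (*-congʳ 1+ι≈0) (zeroˡ _)) (*-congʳ κb≈a)) ⟩
      (g ⊗ g′) ⊗ (0# ⊕ a ⊗ (s ⊗ σ s))
        ≈⟨ solve 5 (λ g g′ a s s′ → (g :* g′) :* (con 0 :+ a :* (s :* s′)) := a :* ((s :* g) :* (s′ :* g′)))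
             ≈-refl g g′ a s (σ s) ⟩
      a ⊗ ((s ⊗ g) ⊗ (σ s ⊗ g′))
        ≈⟨ *-congˡ (*-cong sg≈1 (σ-inverse sg≈1)) ⟩
      a ⊗ (1# ⊗ 1#)
        ≈⟨ ≈-trans (*-congˡ (*-identityˡ 1#)) (*-identityʳ a) ⟩
      a ∎
      where
      z′ = σ z
      w′ = σ w
      g′ = σ g
      A  = 1# ⊕ (z ⊗ z′) ⊗ (w ⊗ w′)
      σ-affine : ∀ z w → σ (g ⊗ (1# ⊕ z ⊗ w)) ≈ g′ ⊗ (1# ⊕ σ z ⊗ σ w)
      σ-affine z w = ≈-trans (σ-* g _)
        (*-congˡ (≈-trans (σ-+ 1# _) (+-cong σ-1 (σ-* z w))))

  sum-of-two-powers : 1 < r → ∀ a → ∃ λ x → ∃ λ y → x ^^ suc r ⊕ y ^^ suc r ≈ a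
  sum-of-two-powers 1<r =
    let z , kz , ¬fz       = ∃-K∖fixed
        d , kd , d+σd≉0    = K∖fixed⇒trace≉0 z kz ¬fz
        j , N[j]≈-1 , _    = norm-surjective ι fixed-ι
        v , ¬kv            = ∃-∉K
    in sum-of-norms N[j]≈-1 kz ¬fz
         -- An element `v` outside K provides the nonzero y = v - σσv.
         (isotropic 1<r kd d+σd≉0 (difference≉0 ¬kv) (difference v (σ (σ v))))
    where
    difference : ∀ x y → (x ⊕ - y) ⊕ y ≈ x
    difference x y = ≈-trans (+-assoc x (- y) y) (≈-trans (+-congˡ (-‿inverseˡ y)) (+-identityʳ x))
    difference≉0 : ∀ {v} → ¬ InK v → ¬ v ⊕ - σ (σ v) ≈ 0#
    difference≉0 {v} ¬kv eq = ¬kv (begin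
      σ (σ v)                              ≈⟨ ≈-sym (+-identityˡ _) ⟩
      0# ⊕ σ (σ v)                         ≈⟨ +-congʳ (≈-sym eq) ⟩
      (v ⊕ - σ (σ v)) ⊕ σ (σ v)            ≈⟨ difference v (σ (σ v)) ⟩
      v                                    ∎)

-- Numerical hypotheses and conclusion.

module _ {c ℓ : Level} where

  -- The exponent t is written `suc (suc s) * 2`, which makes it even, at least 4, and
  -- computationally the successor of `t-1`.
  waring-number-two : ∀ {Q r p} e s → Prim.Prime p → r ≡ p ^ e → 1 < r → Q ≡ r ^ (suc (suc s) * 2) →
    (F : FiniteField c ℓ Q) → WaringNumberIsTwo (FiniteField.fld F) (suc r)
  waring-number-two {zero} _ _ _ _ _ _ F = ⊥-elim (Fin.¬Fin0 (Bijection.to (FiniteField.card F) (FiniteField.0# F)))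
  waring-number-two {suc N} {r@(suc ρ)} {p} e s pr r≡p^e 1<r@(s≤s 0<ρ) Q≡r^t F =
    (λ a → let x , y , eq = Forms.sum-of-two-powers 1<r a
           in x , y , ≈-trans (+-cong (pow≈^ x (suc r)) (pow≈^ y (suc r))) eq) ,
    (λ power → Forms.not-all-powers (λ a → let x , eq = power a in x , ≈-trans (≈-sym (pow≈^ x (suc r))) eq))
    where
    open FiniteField F using (fld; +-cong) renaming (sym to ≈-sym; trans to ≈-trans)
    open FieldProperties fld
    open ℕ.≤-Reasoning

    t-1 = suc (suc s * 2)

    r²≡1+[r²-1] : r ^ 2 ≡ suc (ρ * suc r)
    r²≡1+[r²-1] = trans (cong (r *_) (ℕ.*-identityʳ r)) (cong suc (sym (ℕ.*-suc ρ r)))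

    factor : ∃ λ M → suc (ρ * suc r) ^ suc (suc s) ≡ suc (M * (ρ * suc r))
    factor = [1+R]^s≡1+M*R (ρ * suc r) (suc (suc s))

    N≡M*[r²-1] : N ≡ proj₁ factor * (ρ * suc r)
    N≡M*[r²-1] = ℕ.suc-injective (begin-equality
      suc N                               ≡⟨ Q≡r^t ⟩
      r ^ (suc (suc s) * 2)               ≡⟨ cong (r ^_) (ℕ.*-comm (suc (suc s)) 2) ⟩
      r ^ (2 * suc (suc s))               ≡⟨ sym (ℕ.^-*-assoc r 2 (suc (suc s))) ⟩
      (r ^ 2) ^ suc (suc s)               ≡⟨ cong (_^ suc (suc s)) r²≡1+[r²-1] ⟩
      suc (ρ * suc r) ^ suc (suc s)       ≡⟨ proj₂ factor ⟩
      suc (proj₁ factor * (ρ * suc r))    ∎)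

    -- Since t - 1 > 0, r^{t-1} + 1 < 2r^{t-1} ≤ r^t = N + 1.
    r^[t-1]<N : r ^ t-1 < N
    r^[t-1]<N = ℕ.≤-pred (begin-strict
      suc (r ^ t-1)            <⟨ ℕ.+-monoˡ-< (r ^ t-1) (ℕ.^-monoʳ-< r 1<r {0} {t-1} (s≤s z≤n)) ⟩
      r ^ t-1 + r ^ t-1        ≡⟨ cong (r ^ t-1 +_) (sym (ℕ.+-identityʳ _)) ⟩
      2 * r ^ t-1              ≤⟨ ℕ.*-monoˡ-≤ (r ^ t-1) 1<r ⟩
      r * r ^ t-1              ≡⟨ sym Q≡r^t ⟩
      suc N                    ∎)

    r²-1<N : ρ * suc r < N
    r²-1<N = ℕ.≤-pred (begin-strict
      suc (ρ * suc r)          ≡⟨ sym r²≡1+[r²-1] ⟩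
      r ^ 2                    <⟨ ℕ.^-monoʳ-< r 1<r {2} {suc t-1} (s≤s (s≤s (s≤s z≤n))) ⟩
      r ^ (suc (suc s) * 2)    ≡⟨ sym Q≡r^t ⟩
      suc N                    ∎)

    N+1≡p^ : suc N ≡ p ^ (e * (suc (suc s) * 2))
    N+1≡p^ = trans Q≡r^t (trans (cong (_^ (suc (suc s) * 2)) r≡p^e) (ℕ.^-*-assoc p e (suc (suc s) * 2)))

    frobenius-r : AdditivePower r
    frobenius-r = subst AdditivePower (sym r≡p^e)
      (frobenius pr (FiniteFieldProperties.characteristic N F {n = e * (suc (suc s) * 2)} N+1≡p^) e)

    module Forms = FrobeniusForms N F ρ t-1 (proj₁ factor) Q≡r^t N≡M*[r²-1] r^[t-1]<N r²-1<N frobenius-r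

theorem7p1 : ∀ {c ℓ' : Level} (q m ℓ : ℕ) → IsPrimePower q → 1 ≤ m →
    1 ≤ ℓ → 2 * ℓ < m → ℓ ∣ m → (Σ ℕ λ t → m ≡ t * ℓ × 2 ∣ t) →
    gcd (q ^ ℓ + 1) (q ^ m ∸ 1) ≢ q ^ (m / 2) + 1 →
    (F : FiniteField c ℓ' (q ^ m)) →
    WaringNumberIsTwo (FiniteField.fld F) (q ^ ℓ + 1)
theorem7p1 q m ℓ (p , n , pr , 1≤n , q≡p^n) _ 1≤ℓ 2ℓ<m _ (_ , m≡tℓ , Div.divides s refl) _ F =
  subst (WaringNumberIsTwo (FiniteField.fld F)) (ℕ.+-comm 1 (q ^ ℓ)) (by-cases s m≡tℓ)
  where
  r≡p^[nℓ] : q ^ ℓ ≡ p ^ (n * ℓ)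
  r≡p^[nℓ] = trans (cong (_^ ℓ) q≡p^n) (ℕ.^-*-assoc p n ℓ)
  1<p : 1 < p
  1<p = nonTrivial⇒n>1 p {{Prim.prime⇒nonTrivial pr}}
  1<r : 1 < q ^ ℓ
  1<r = subst (1 <_) (sym r≡p^[nℓ]) (ℕ.^-monoʳ-< p 1<p {0} (ℕ.*-mono-≤ 1≤n 1≤ℓ))
  by-cases : ∀ s → m ≡ s * 2 * ℓ → WaringNumberIsTwo (FiniteField.fld F) (suc (q ^ ℓ))
  -- `s` is half of m/ℓ; the values 0 and 1 contradict 2ℓ < m.
  by-cases zero          m≡ = ⊥-elim (ℕ.<⇒≱ 2ℓ<m (subst (_≤ 2 * ℓ) (sym m≡) z≤n))
  by-cases (suc zero)    m≡ = ⊥-elim (ℕ.<-irrefl (sym m≡) 2ℓ<m)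
  by-cases (suc (suc s)) m≡ = waring-number-two (n * ℓ) s pr r≡p^[nℓ] 1<r
    (trans (cong (q ^_) (trans m≡ (ℕ.*-comm (suc (suc s) * 2) ℓ))) (sym (ℕ.^-*-assoc q ℓ (suc (suc s) * 2)))) F
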